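{- Let $X$ and $Y$ be metric spaces. Assume that $X$ is separable, that all the closed subsets of $X$ are Baire spaces, and that $A\subseteq Y^X$. The following conditions are equivalent: (1) $A$ is equi-Baire class one. (2) For each $\varepsilon>0$ there exists a sequence $(G^\varepsilon_m)_{m\in\omega}$ of closed subsets of $X$, whose union is $X$, such that for each $f\in A$ and each integer $m$, $\mathrm{diam}(f[G^\varepsilon_m])<\varepsilon$. (3) There exists a metrizable separable topology on $X$, finer than the original topology, all of whose open sets are $F_\sigma$ subsets of $X$ for the original topology, making $A$ equicontinuous. (4) Every nonempty closed subset $F$ of $X$ contains a point $x$ such that $\{f_{|F} : f\in A\}$ is equicontinuous at $x$.
   Context: $\mathcal{B}_1(X,\mathbb{R}^*_+)$ is the set of Baire class one functions $X\to(0,\infty)$, i.e. those for which preimages of open sets are $F_\sigma$. $A\subseteq Y^X$ is equi-Baire class one if for each $\varepsilon>0$ there exists $\delta(\varepsilon)\in\mathcal{B}_1(X,\mathbb{R}^*_+)$ such that for all $x,x'\in X$: $d_X(x,x')<\min(\delta(\varepsilon)(x),\delta(\varepsilon)(x'))$ implies $d_Y(f(x),f(x'))<\varepsilon$ for all $f\in A$. -}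

module Defs where

open import Level using (Level; _⊔_; 0ℓ; suc)
open import Data.Nat.Base using (ℕ)
open import Data.Maybe.Base using (Maybe; just)
open import Data.Product using (Σ-syntax; ∃-syntax; _×_; _,_; proj₁; proj₂)
open import Data.Rational.Base as ℚ using (ℚ; 0ℚ; 1ℚ)
import Data.Rational.Properties as ℚ
open import Data.Sum.Base using (inj₁; inj₂; map)
open import Data.Unit.Polymorphic.Base using (⊤)
open import Function.Base using (id; _∘_)
open import Function.Bundles using (Func; _⟨$⟩_; _⇔_)
open import Function.Metric.Structures using (IsGeneralMetric; module IsGeneralMetric)
open import Relation.Binary.Bundles using (Setoid)
open import Relation.Binary.Core using (Rel)
open import Relation.Binary.Definitions using (_Respects_; tri<; tri≈; tri>)
open import Relation.Binary.Structures using (IsPartialOrder)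
open import Relation.Binary.PropositionalEquality.Core
  using (_≡_; refl; sym; trans; cong; subst)
import Relation.Binary.Construct.On as On
open import Relation.Nullary using (contradiction)
open import Relation.Unary
  using (Pred; _∈_; _∉_; _⊆_; _≐_; _∩_; _∪_; ∁; _⊢_; ⋃; ⋂; _≬_; Satisfiable)

private
  variable
    c e c′ e′ f p o o′ ℓ : Level

-- Dedekind lower cuts in ℚ.  Without excluded middle these would only be
-- the (bounded) lower reals.

record ℝ : Set₁ where
  field
    cut       : Pred ℚ 0ℓ
    inhabited : ∃[ q ] q ∈ cut
    proper    : ∃[ q ] q ∉ cut
    lower     : ∀ {q r} → q ℚ.< r → r ∈ cut → q ∈ cut
    noMax     : ∀ {q} → q ∈ cut → ∃[ r ] q ℚ.< r × r ∈ cut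

open ℝ public

infix 4 _≈ᴿ_ _≤ᴿ_ _<ᴿ_
infixl 6 _+ᴿ_
infixl 7 _⊓ᴿ_
infixl 6 _⊔ᴿ_

_≈ᴿ_ : Rel ℝ 0ℓ
x ≈ᴿ y = cut x ≐ cut y

_≤ᴿ_ : Rel ℝ 0ℓ
x ≤ᴿ y = cut x ⊆ cut y

_<ᴿ_ : Rel ℝ 0ℓ
x <ᴿ y = ∃[ q ] q ∉ cut x × q ∈ cut y

≤ᴿ-isPartialOrder : IsPartialOrder _≈ᴿ_ _≤ᴿ_
≤ᴿ-isPartialOrder = record
  { isPreorder = record
    { isEquivalence = record
      { refl  = id , id
      ; sym   = λ (a , b) → b , a
      ; trans = λ (a , b) (a′ , b′) → a′ ∘ a , b ∘ b′
      }
    ; reflexive = proj₁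
    ; trans     = λ a b → b ∘ a
    }
  ; antisym = _,_
  }

ℝ-setoid : Setoid (suc 0ℓ) 0ℓ
ℝ-setoid = record
  { isEquivalence = IsPartialOrder.isEquivalence ≤ᴿ-isPartialOrder }

∈∉⇒< : ∀ (x : ℝ) {q r} → q ∈ cut x → r ∉ cut x → q ℚ.< r
∈∉⇒< x {q} {r} q∈ r∉ with ℚ.<-cmp q r
... | tri< q<r _ _ = q<r
... | tri≈ _ q≡r _ = contradiction (subst (_∈ cut x) q≡r q∈) r∉
... | tri> _ _ r<q = contradiction (lower x r<q q∈) r∉

fromℚ : ℚ → ℝ
fromℚ p = record
  { cut       = ℚ._< p
  ; inhabited = p ℚ.- 1ℚ , p-1<p
  ; proper    = p , ℚ.<-irrefl refl
  ; lower     = ℚ.<-trans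
  ; noMax     = ℚ.<-dense
  }
  where
  p-1<p : p ℚ.- 1ℚ ℚ.< p
  p-1<p = subst (p ℚ.- 1ℚ ℚ.<_) (ℚ.+-identityʳ p)
            (ℚ.+-monoʳ-< p (ℚ.negative⁻¹ (ℚ.- 1ℚ)))

0ᴿ : ℝ
0ᴿ = fromℚ 0ℚ

private
  p+[q-p]≡q : ∀ p q → p ℚ.+ (q ℚ.- p) ≡ q
  p+[q-p]≡q p q = trans (cong (p ℚ.+_) (ℚ.+-comm q (ℚ.- p)))
    (trans (sym (ℚ.+-assoc p (ℚ.- p) q))
    (trans (cong (ℚ._+ q) (ℚ.+-inverseʳ p)) (ℚ.+-identityˡ q)))

  [p+q]-p≡q : ∀ p q → (p ℚ.+ q) ℚ.- p ≡ q
  [p+q]-p≡q p q = trans (ℚ.+-assoc p q (ℚ.- p)) (p+[q-p]≡q p q)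

_+ᴿ_ : ℝ → ℝ → ℝ
x +ᴿ y = record
  { cut       = λ r → ∃[ p ] ∃[ q ] p ∈ cut x × q ∈ cut y × r ≡ p ℚ.+ q
  ; inhabited = _ , _ , _ , proj₂ (inhabited x) , proj₂ (inhabited y) , refl
  ; proper    =
      let u , u∉ = proper x ; v , v∉ = proper y in
      u ℚ.+ v , λ (p , q , p∈ , q∈ , eq) → ℚ.<-irrefl (sym eq)
        (ℚ.+-mono-< (∈∉⇒< x p∈ u∉) (∈∉⇒< y q∈ v∉))
  ; lower     = λ { {r} r<s (p , q , p∈ , q∈ , refl) →
      p , r ℚ.- p , p∈
      , lower y (subst (r ℚ.- p ℚ.<_) ([p+q]-p≡q p q) (ℚ.+-monoˡ-< (ℚ.- p) r<s)) q∈
      , sym (p+[q-p]≡q p r) }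
  ; noMax     = λ { (p , q , p∈ , q∈ , refl) →
      let q′ , q<q′ , q′∈ = noMax y q∈ in
      p ℚ.+ q′ , ℚ.+-monoʳ-< p q<q′ , p , q′ , p∈ , q′∈ , refl }
  }

private
  ⊓-elim : ∀ (P : Pred ℚ ℓ) {q r} → q ∈ P → r ∈ P → q ℚ.⊓ r ∈ P
  ⊓-elim P {q} {r} q∈ r∈ with ℚ.⊓-sel q r
  ... | inj₁ eq = subst P (sym eq) q∈
  ... | inj₂ eq = subst P (sym eq) r∈

  ⊔-elim : ∀ (P : Pred ℚ ℓ) {q r} → q ∈ P → r ∈ P → q ℚ.⊔ r ∈ P
  ⊔-elim P {q} {r} q∈ r∈ with ℚ.⊔-sel q r
  ... | inj₁ eq = subst P (sym eq) q∈
  ... | inj₂ eq = subst P (sym eq) r∈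

  lower≤ : ∀ (x : ℝ) {q r} → q ℚ.≤ r → r ∈ cut x → q ∈ cut x
  lower≤ x q≤r r∈ = let s , r<s , s∈ = noMax x r∈ in lower x (ℚ.≤-<-trans q≤r r<s) s∈

_⊓ᴿ_ : ℝ → ℝ → ℝ
x ⊓ᴿ y = record
  { cut       = cut x ∩ cut y
  ; inhabited =
      let q , q∈ = inhabited x ; r , r∈ = inhabited y
      in q ℚ.⊓ r , lower≤ x (ℚ.p⊓q≤p q r) q∈ , lower≤ y (ℚ.p⊓q≤q q r) r∈
  ; proper    = let q , q∉ = proper x in q , q∉ ∘ proj₁
  ; lower     = λ q<r (a , b) → lower x q<r a , lower y q<r b
  ; noMax     = λ {q} (a , b) →
      let r , q<r , r∈ = noMax x a ; s , q<s , s∈ = noMax y b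
      in r ℚ.⊓ s , ⊓-elim (q ℚ.<_) q<r q<s
       , lower≤ x (ℚ.p⊓q≤p r s) r∈ , lower≤ y (ℚ.p⊓q≤q r s) s∈
  }

_⊔ᴿ_ : ℝ → ℝ → ℝ
x ⊔ᴿ y = record
  { cut       = cut x ∪ cut y
  ; inhabited = let q , q∈ = inhabited x in q , inj₁ q∈
  ; proper    =
      let q , q∉ = proper x ; r , r∉ = proper y
      in q ℚ.⊔ r , λ { (inj₁ a) → q∉ (lower≤ x (ℚ.p≤p⊔q q r) a)
                     ; (inj₂ b) → r∉ (lower≤ y (ℚ.p≤q⊔p q r) b) }
  ; lower     = λ q<r → map (lower x q<r) (lower y q<r)
  ; noMax     = λ { (inj₁ a) → let r , q<r , r∈ = noMax x a in r , q<r , inj₁ r∈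
                  ; (inj₂ b) → let r , q<r , r∈ = noMax y b in r , q<r , inj₂ r∈ }
  }

<ᴿ-≤ᴿ-trans : ∀ {x y z} → x <ᴿ y → y ≤ᴿ z → x <ᴿ z
<ᴿ-≤ᴿ-trans (q , q∉ , q∈) y≤z = q , q∉ , y≤z q∈

≤ᴿ-<ᴿ-trans : ∀ {x y z} → x ≤ᴿ y → y <ᴿ z → x <ᴿ z
≤ᴿ-<ᴿ-trans x≤y (q , q∉ , q∈) = q , q∉ ∘ x≤y , q∈

⊓ᴿ-glb-< : ∀ {x y z} → x <ᴿ y → x <ᴿ z → x <ᴿ y ⊓ᴿ z
⊓ᴿ-glb-< {x} {y} {z} (q , q∉ , q∈) (r , r∉ , r∈) =
  q ℚ.⊓ r , ⊓-elim (_∉ cut x) q∉ r∉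
  , lower≤ y (ℚ.p⊓q≤p q r) q∈ , lower≤ z (ℚ.p⊓q≤q q r) r∈

⊔ᴿ-lub-< : ∀ {x y z} → x <ᴿ z → y <ᴿ z → x ⊔ᴿ y <ᴿ z
⊔ᴿ-lub-< {x} {y} {z} (q , q∉ , q∈) (r , r∉ , r∈) =
  q ℚ.⊔ r
  , (λ { (inj₁ a) → q∉ (lower≤ x (ℚ.p≤p⊔q q r) a)
       ; (inj₂ b) → r∉ (lower≤ y (ℚ.p≤q⊔p q r) b) })
  , ⊔-elim (cut z) q∈ r∈

∃-below : ∀ x → ∃[ a ] a <ᴿ x
∃-below x = let q , q∈ = inhabited x in fromℚ q , q , ℚ.<-irrefl refl , q∈

∃-above : ∀ x → ∃[ b ] x <ᴿ b
∃-above x =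
  let q , q∉ = proper x
  in fromℚ (q ℚ.+ 1ℚ) , q , q∉
   , subst (ℚ._< q ℚ.+ 1ℚ) (ℚ.+-identityʳ q) (ℚ.+-monoʳ-< q (ℚ.positive⁻¹ 1ℚ))

-- Subsets of the space live in a fixed universe level p, and arbitrary
-- unions are indexed by types of that level.  If the points also live at
-- level p this is no restriction: by choice, an open set that is a union
-- of open sets is a union of such sets indexed by its own points.

record Topology (S : Setoid c e) p o : Set (c ⊔ e ⊔ suc (p ⊔ o)) where
  open Setoid S using (Carrier; _≈_)
  field
    IsOpen         : Pred (Pred Carrier p) o
    IsOpen-resp-≐  : IsOpen Respects _≐_
    open-resp-≈    : ∀ {U} → IsOpen U → U Respects _≈_
    whole-open     : IsOpen (λ _ → ⊤)
    ∩-open         : ∀ {U V} → IsOpen U → IsOpen V → IsOpen (U ∩ V)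
    ⋃-open         : ∀ {I : Set p} {U : I → Pred Carrier p} →
                     (∀ i → IsOpen (U i)) → IsOpen (⋃ I U)

  IsClosed : Pred (Pred Carrier p) o
  IsClosed C = IsOpen (∁ C)

  IsFσ : Pred (Pred Carrier ℓ) _
  IsFσ P = ∃[ C ] (∀ n → IsClosed (C n)) × P ≐ ⋃ ℕ C

  IsDense : Pred (Pred Carrier ℓ) _
  IsDense D = ∀ U → IsOpen U → Satisfiable U → U ≬ D

  -- Maybe allows for the empty set.
  IsCountable : Pred (Pred Carrier ℓ) _
  IsCountable D = Σ[ enum ∈ (ℕ → Maybe Carrier) ]
    ∀ x → x ∈ D → ∃[ n ] ∃[ y ] enum n ≡ just y × x ≈ y

  IsSeparable : Set _
  IsSeparable = Σ[ D ∈ Pred Carrier p ] IsCountable D × IsDense D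

  IsBaire : Set _
  IsBaire = ∀ (U : ℕ → Pred Carrier p) →
    (∀ n → IsOpen (U n)) → (∀ n → IsDense (U n)) → IsDense (⋂ ℕ U)

subsetoid : (S : Setoid c e) → Pred (Setoid.Carrier S) f → Setoid (c ⊔ f) e
subsetoid S F = On.setoid S (proj₁ {B = F})

subspace : {S : Setoid c e} → Topology S p o → (F : Pred (Setoid.Carrier S) f) →
           Topology (subsetoid S F) p (c ⊔ f ⊔ suc p ⊔ o)
subspace T F = record
  { IsOpen        = λ U → ∃[ V ] IsOpen V × (proj₁ ⊢ V) ≐ U
  ; IsOpen-resp-≐ = λ (U⊆ , ⊆U) (V , oV , V⊆ , ⊆V) → V , oV , U⊆ ∘ V⊆ , ⊆V ∘ ⊆U
  ; open-resp-≈   = λ (V , oV , V⊆ , ⊆V) x≈y → V⊆ ∘ open-resp-≈ oV x≈y ∘ ⊆V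
  ; whole-open    = _ , whole-open , _ , _
  ; ∩-open        = λ (V , oV , V⊆ , ⊆V) (W , oW , W⊆ , ⊆W) → V ∩ W , ∩-open oV oW
                  , (λ (a , b) → V⊆ a , W⊆ b) , (λ (a , b) → ⊆V a , ⊆W b)
  ; ⋃-open        = λ o → ⋃ _ (proj₁ ∘ o) , ⋃-open (proj₁ ∘ proj₂ ∘ o)
                  , (λ (i , a) → i , proj₁ (proj₂ (proj₂ (o i))) a)
                  , (λ (i , a) → i , proj₂ (proj₂ (proj₂ (o i))) a)
  }
  where open Topology T

-- The order topology, which on ℝ is that of |x - y|.
ℝ-topology : Topology ℝ-setoid (suc 0ℓ) (suc 0ℓ)
ℝ-topology = record
  { IsOpen        = λ U → ∀ {x} → x ∈ U → ∃[ a ] ∃[ b ]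
                      a <ᴿ x × x <ᴿ b × (∀ {y} → a <ᴿ y → y <ᴿ b → y ∈ U)
  ; IsOpen-resp-≐ = λ (U⊆ , ⊆U) oU x∈ →
      let a , b , a<x , x<b , h = oU (⊆U x∈)
      in a , b , a<x , x<b , λ {y} a<y y<b → U⊆ (h {y} a<y y<b)
  ; open-resp-≈   = λ {_} oU {x} {y} (x≤y , y≤x) x∈ →
      let a , b , a<x , x<b , h = oU x∈
      in h {y} (<ᴿ-≤ᴿ-trans {a} {x} {y} a<x x≤y) (≤ᴿ-<ᴿ-trans {y} {x} {b} y≤x x<b)
  ; whole-open    = λ {x} _ →
      let a , a<x = ∃-below x ; b , x<b = ∃-above x
      in a , b , a<x , x<b , _
  ; ∩-open        = λ oU oV {x} (x∈U , x∈V) →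
      let a , b , a<x , x<b , h = oU x∈U
          c , d , c<x , x<d , k = oV x∈V
      in a ⊔ᴿ c , b ⊓ᴿ d , ⊔ᴿ-lub-< {a} {c} {x} a<x c<x , ⊓ᴿ-glb-< {x} {b} {d} x<b x<d
       , λ {y} (q , q∉ , q∈) (r , r∉ , r∈b , r∈d) →
           h {y} (q , q∉ ∘ inj₁ , q∈) (r , r∉ , r∈b)
         , k {y} (q , q∉ ∘ inj₂ , q∈) (r , r∉ , r∈d)
  ; ⋃-open        = λ oU (i , x∈) →
      let a , b , a<x , x<b , h = oU i x∈
      in a , b , a<x , x<b , λ {y} a<y y<b → i , h {y} a<y y<b
  }

ℝ₊* : Setoid (suc 0ℓ) 0ℓ
ℝ₊* = subsetoid ℝ-setoid (0ᴿ <ᴿ_)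

ℝ₊*-topology : Topology ℝ₊* (suc 0ℓ) (suc (suc 0ℓ))
ℝ₊*-topology = subspace ℝ-topology (0ᴿ <ᴿ_)

BaireClassOne : {S : Setoid c e} {R : Setoid c′ e′} →
                Topology S p o → Topology R f o′ → Pred (Func S R) _
BaireClassOne T T′ g =
  ∀ U → Topology.IsOpen T′ U → Topology.IsFσ T ((g ⟨$⟩_) ⊢ U)

IsMetric : {X : Set c} → Rel X e → (X → X → ℝ) → Set _
IsMetric _≈_ d = IsGeneralMetric _≈_ _≈ᴿ_ _≤ᴿ_ 0ᴿ _+ᴿ_ d

record MetricSpace c e : Set (suc (c ⊔ e ⊔ suc 0ℓ)) where
  infix 4 _≈_
  field
    Carrier  : Set c
    _≈_      : Rel Carrier e
    dist     : Carrier → Carrier → ℝ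
    isMetric : IsMetric _≈_ dist

  setoid : Setoid c e
  setoid = record { isEquivalence = IsGeneralMetric.≈-isEquivalence isMetric }

MetricOpen : {X : Set c} → (X → X → ℝ) → Pred (Pred X p) _
MetricOpen d U = ∀ {x} → x ∈ U → ∃[ r ] 0ᴿ <ᴿ r × (∀ {y} → d x y <ᴿ r → y ∈ U)

metricTopology : (X : MetricSpace c e) → Topology (MetricSpace.setoid X) c (suc 0ℓ ⊔ c)
metricTopology X = record
  { IsOpen        = MetricOpen dist
  ; IsOpen-resp-≐ = λ (U⊆ , ⊆U) oU x∈ →
      let r , 0<r , h = oU (⊆U x∈) in r , 0<r , U⊆ ∘ h
  ; open-resp-≈   = λ oU {x} {y} x≈y x∈ →
      let r , 0<r , h = oU x∈
      in h (≤ᴿ-<ᴿ-trans {dist x y} {0ᴿ} {r} (proj₁ (≈⇒0 x≈y)) 0<r)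
  ; whole-open    = λ _ → let r , 0<r = ∃-above 0ᴿ in r , 0<r , _
  ; ∩-open        = λ oU oV (x∈U , x∈V) →
      let r , 0<r , h = oU x∈U ; s , 0<s , k = oV x∈V
      in r ⊓ᴿ s , ⊓ᴿ-glb-< {0ᴿ} {r} {s} 0<r 0<s
       , λ (q , q∉ , q∈r , q∈s) → h (q , q∉ , q∈r) , k (q , q∉ , q∈s)
  ; ⋃-open        = λ oU (i , x∈) →
      let r , 0<r , h = oU i x∈ in r , 0<r , λ d<r → i , h d<r
  }
  where
  open MetricSpace X
  open IsGeneralMetric isMetric using (≈⇒0)

IsMetrizable : {S : Setoid c e} → Topology S p o → Set _
IsMetrizable {S = S} T =
  ∃[ d ] IsMetric _≈_ d × (∀ U → Topology.IsOpen T U ⇔ MetricOpen d U)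
  where open Setoid S using (_≈_)

module _ (Y : MetricSpace c e) where
  open MetricSpace Y

  -- The diameter is a supremum in [0,∞], so that of ∅ is 0; a set whose
  -- distances are unbounded has no diameter in ℝ.
  HasDiameter : Pred Carrier ℓ → ℝ → Set _
  HasDiameter P r = IsBound r × (∀ s → IsBound s → r ≤ᴿ s)
    where
    IsBound : ℝ → Set _
    IsBound s = 0ᴿ ≤ᴿ s × (∀ {y y′} → y ∈ P → y′ ∈ P → dist y y′ ≤ᴿ s)

diam[_]_<_ : (Y : MetricSpace c e) → Pred (MetricSpace.Carrier Y) ℓ → ℝ → Set _
diam[ Y ] P < ε = ∃[ r ] HasDiameter Y P r × r <ᴿ ε

image : {S : Setoid c e} {R : Setoid c′ e′} → Func S R →
        Pred (Setoid.Carrier S) ℓ → Pred (Setoid.Carrier R) _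
image {R = R} g P y = ∃[ x ] x ∈ P × (g ⟨$⟩ x) ≈ y
  where open Setoid R using (_≈_)

restrict : {S : Setoid c e} {R : Setoid c′ e′} → Pred (Func S R) ℓ →
           (F : Pred (Setoid.Carrier S) f) → Pred (Func (subsetoid S F) R) _
restrict {R = R} A F g = ∃[ h ] h ∈ A × (∀ z → (g ⟨$⟩ z) ≈ (h ⟨$⟩ proj₁ z))
  where open Setoid R using (_≈_)

module _ {S : Setoid c e} (T : Topology S p o) (Y : MetricSpace c′ e′)
         (A : Pred (Func S (MetricSpace.setoid Y)) ℓ) where
  open Topology T
  open MetricSpace Y using (dist)

  EquicontinuousAt : Setoid.Carrier S → Set _
  EquicontinuousAt x = ∀ ε → 0ᴿ <ᴿ ε → ∃[ U ] IsOpen U × x ∈ U ×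
    (∀ g → g ∈ A → ∀ y → y ∈ U → dist (g ⟨$⟩ x) (g ⟨$⟩ y) <ᴿ ε)

  Equicontinuous : Set _
  Equicontinuous = ∀ x → EquicontinuousAt x

module _ (X : MetricSpace c e) (Y : MetricSpace c′ e′)
         (A : Pred (Func (MetricSpace.setoid X) (MetricSpace.setoid Y)) ℓ) where
  private
    module X = MetricSpace X
    module Y = MetricSpace Y

  EquiBaireClassOne : Set _
  EquiBaireClassOne = ∀ ε → 0ᴿ <ᴿ ε →
    Σ[ δ ∈ Func X.setoid ℝ₊* ] BaireClassOne (metricTopology X) ℝ₊*-topology δ ×
      (∀ x x′ → X.dist x x′ <ᴿ proj₁ (δ ⟨$⟩ x) ⊓ᴿ proj₁ (δ ⟨$⟩ x′) →
        ∀ g → g ∈ A → Y.dist (g ⟨$⟩ x) (g ⟨$⟩ x′) <ᴿ ε)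

{-# OPTIONS --safe #-}
-- Each condition is compared with: for every q > 0 the space is a countable union of closed
-- sets on which every f ∈ A oscillates by at most q.
-- From (1), the sets {δ > 1/n} are Fσ and are cut into pieces of diameter at most 1/n;
-- conversely, δ(x) is at most the distance from x to the sets preceding the first one containing x.
-- For (3), label each point by the first set containing it and add to the metric the ultrametric
-- comparing labels; conversely, Lindelöf applies to the finer topology.
-- From the covers to (4), by Baire a point lies in the relative interior of every piece that
-- contains it; conversely, the points without a neighbourhood admitting a small cover form a
-- closed set, which has no point of equicontinuity.

module Submission where

open import Defs
open import Level using (Level; _⊔_; 0ℓ; suc; Lift; lift)
import Data.Integer.Base as ℤ
open import Data.Nat.Base as ℕ using (ℕ)
import Data.Nat.Properties as ℕ
open import Data.Nat.Coprimality using (1-coprimeTo)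
open import Data.Nat.Induction using (<-wellFounded)
open import Data.Maybe.Base using (Maybe; just; nothing)
open import Data.Product using (Σ-syntax; ∃-syntax; _×_; _,_; proj₁; proj₂)
open import Data.Rational.Base as ℚ using (ℚ; mkℚ; 0ℚ; 1ℚ; ½)
import Data.Rational.Properties as ℚ
open import Data.Sum.Base using (_⊎_; inj₁; inj₂; [_,_]′)
open import Data.Empty using (⊥)
open import Data.Unit.Polymorphic.Base using (⊤)
open import Function.Base using (_∘_; id; case_of_)
open import Function.Bundles using (Func; _⟨$⟩_; _⇔_; mk⇔; Equivalence)
open import Function.Metric.Structures using (module IsGeneralMetric)
open import Induction.WellFounded using (Acc; acc)
open import Axiom.ExcludedMiddle using (ExcludedMiddle)
open import Relation.Binary.Bundles using (Setoid)
open import Relation.Binary.Structures using (IsEquivalence)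
open import Relation.Binary.Definitions using (_Respects_; tri<; tri≈; tri>)
open import Relation.Binary.PropositionalEquality
  using (_≡_; _≢_; refl; sym; trans; cong; subst; subst₂)
open import Relation.Nullary using (¬_; Dec; yes; no; contradiction)
open import Relation.Nullary.Decidable using (True; toWitness; fromWitness; decidable-stable)
open import Relation.Unary
  using (Pred; _∈_; _∉_; _⊆_; _≐_; _∩_; _∪_; ∁; U; ∅; ⋃; _⊢_; Satisfiable; Universal)

private
  variable
    a c e c′ e′ ℓ ℓ′ o : Level

-- Rational arithmetic and an enumeration of pairs of natural numbers.

half : ℚ → ℚ
half q = ½ ℚ.* q

half+half≡ : ∀ q → half q ℚ.+ half q ≡ q
half+half≡ q = trans (sym (ℚ.*-distribʳ-+ q ½ ½)) (ℚ.*-identityˡ q)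

half-pos : ∀ {q} → 0ℚ ℚ.< q → 0ℚ ℚ.< half q
half-pos {q} 0<q = subst (ℚ._< half q) (ℚ.*-zeroʳ ½) (ℚ.*-monoʳ-<-pos ½ 0<q)

half-< : ∀ {q} → 0ℚ ℚ.< q → half q ℚ.< q
half-< {q} 0<q = subst₂ ℚ._<_ (ℚ.+-identityʳ (half q)) (half+half≡ q)
  (ℚ.+-monoʳ-< (half q) (half-pos 0<q))

p+[q-p]≡q : ∀ p q → p ℚ.+ (q ℚ.- p) ≡ q
p+[q-p]≡q p q = trans (cong (p ℚ.+_) (ℚ.+-comm q (ℚ.- p)))
  (trans (sym (ℚ.+-assoc p (ℚ.- p) q))
  (trans (cong (ℚ._+ q) (ℚ.+-inverseʳ p)) (ℚ.+-identityˡ q)))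

<⇒∃+ : ∀ {p q} → p ℚ.< q → ∃[ e ] 0ℚ ℚ.< e × p ℚ.+ e ≡ q
<⇒∃+ {p} {q} p<q = q ℚ.- p
  , subst (ℚ._< q ℚ.- p) (ℚ.+-inverseʳ p) (ℚ.+-monoˡ-< (ℚ.- p) p<q)
  , p+[q-p]≡q p q

1/1+ : ℕ → ℚ
1/1+ k = mkℚ (ℤ.+ 1) k (1-coprimeTo (ℕ.suc k))

1/1+-pos : ∀ k → 0ℚ ℚ.< 1/1+ k
1/1+-pos k = ℚ.positive⁻¹ (1/1+ k)

1/1+-anti : ∀ {m n} → m ℕ.≤ n → 1/1+ n ℚ.≤ 1/1+ m
1/1+-anti m≤n = ℚ.*≤* (ℤ.+≤+ (ℕ.*-monoʳ-≤ 1 (ℕ.s≤s m≤n)))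

-- The denominator of `q` serves as the bound, since a positive numerator is at least 1.
archimedean : ∀ {q} → 0ℚ ℚ.< q → ∃[ k ] 1/1+ k ℚ.≤ q
archimedean {mkℚ (ℤ.+ ℕ.zero) d _} (ℚ.*<* (ℤ.+<+ ()))
archimedean {mkℚ ℤ.+[1+ n ] d _} _ = d , ℚ.*≤* (ℤ.+≤+ (ℕ.*-monoˡ-≤ (ℕ.suc d) (ℕ.s≤s (ℕ.z≤n {n}))))
archimedean {mkℚ (ℤ.-[1+ n ]) d _} (ℚ.*<* ())

private
  step : ℕ × ℕ → ℕ × ℕ
  step (ℕ.zero  , b) = ℕ.suc b , 0
  step (ℕ.suc a , b) = a , ℕ.suc b

-- Cantor's walk along the antidiagonals `a + b = s`, each running from `(s , 0)` to `(0 , s)`.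
unpair : ℕ → ℕ × ℕ
unpair ℕ.zero    = 0 , 0
unpair (ℕ.suc n) = step (unpair n)

unpair-surjective : ∀ a b → ∃[ n ] unpair n ≡ (a , b)
unpair-surjective a b = go (a ℕ.+ b) b a refl
  where
  go : ∀ s b a → a ℕ.+ b ≡ s → ∃[ n ] unpair n ≡ (a , b)
  go ℕ.zero    ℕ.zero    ℕ.zero    _  = 0 , refl
  go (ℕ.suc s) ℕ.zero    (ℕ.suc a) eq =
    let n , unpair≡ = go s s 0 refl
        s≡a = trans (sym (ℕ.suc-injective eq)) (ℕ.+-identityʳ a)
    in ℕ.suc n , trans (cong step unpair≡) (cong (λ m → ℕ.suc m , 0) s≡a)
  go s         (ℕ.suc b) a         eq =
    let n , unpair≡ = go s b (ℕ.suc a) (trans (sym (ℕ.+-suc a b)) eq)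
    in ℕ.suc n , cong step unpair≡

-- Positivity and sums of cuts.

0ᴿ<fromℚ : ∀ {q} → 0ℚ ℚ.< q → 0ᴿ <ᴿ fromℚ q
0ᴿ<fromℚ 0<q = 0ℚ , ℚ.<-irrefl refl , 0<q

-- The witness of `0ᴿ <ᴿ r` may be 0 itself; `noMax` moves strictly above it.
∃-pos∈cut : ∀ {r} → 0ᴿ <ᴿ r → ∃[ q ] 0ℚ ℚ.< q × q ∈ cut r
∃-pos∈cut {r} (p , p≮0 , p∈) =
  let q , p<q , q∈ = noMax r p∈ in q , ℚ.≤-<-trans (ℚ.≮⇒≥ p≮0) p<q , q∈

cut-≤ : ∀ r {p q} → p ℚ.≤ q → q ∈ cut r → p ∈ cut r
cut-≤ r p≤q q∈ =
  let s , q<s , s∈ = noMax r q∈ in lower r (ℚ.≤-<-trans p≤q q<s) s∈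

x≤x+y : ∀ x y → 0ᴿ ≤ᴿ y → x ≤ᴿ x +ᴿ y
x≤x+y x y 0≤y {p} p∈ =
  let q , p<q , q∈ = noMax x p∈
      p-q<0 = subst (p ℚ.- q ℚ.<_) (ℚ.+-inverseʳ q) (ℚ.+-monoˡ-< (ℚ.- q) p<q)
  in q , p ℚ.- q , q∈ , 0≤y p-q<0 , sym (p+[q-p]≡q q p)

x≤y+x : ∀ x y → 0ᴿ ≤ᴿ y → x ≤ᴿ y +ᴿ x
x≤y+x x y 0≤y p∈ =
  let q , r , q∈ , r∈ , p≡ = x≤x+y x y 0≤y p∈
  in r , q , r∈ , q∈ , trans p≡ (ℚ.+-comm q r)

-- Metric spaces described by closed balls of rational radius.

module Near (M : MetricSpace c e) where
  open MetricSpace M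
  open IsGeneralMetric isMetric
    using (nonNegative; ≈⇒0; 0⇒≈; triangle)
    renaming (cong to dist-cong; sym to dist-sym)

  -- d(x,y) ≤ q; this lets all radii below be rational.
  near : ℚ → Carrier → Pred Carrier 0ℓ
  near q x y = q ∉ cut (dist x y)

  near-refl : ∀ {q x y} → 0ℚ ℚ.≤ q → x ≈ y → near q x y
  near-refl 0≤q x≈y q∈ = ℚ.<-irrefl refl (ℚ.≤-<-trans 0≤q (proj₁ (≈⇒0 x≈y) q∈))

  near-sym : ∀ {q x y} → near q x y → near q y x
  near-sym {x = x} {y} xy = xy ∘ proj₁ (dist-sym y x)

  near-mono : ∀ {p q x y} → p ℚ.≤ q → near p x y → near q x y
  near-mono {x = x} {y} p≤q xy = xy ∘ cut-≤ (dist x y) p≤q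

  near-trans : ∀ {p q x y z} → near p x y → near q y z → near (p ℚ.+ q) x z
  near-trans {p} {q} {x} {y} {z} xy yz p+q∈ =
    let p′ , q′ , p′∈ , q′∈ , p+q≡ = triangle x y z p+q∈
    in ℚ.<-irrefl (sym p+q≡)
         (ℚ.+-mono-< (∈∉⇒< (dist x y) p′∈ xy) (∈∉⇒< (dist y z) q′∈ yz))

  near-resp : ∀ {q x x′ y y′} → x ≈ x′ → y ≈ y′ → near q x y → near q x′ y′
  near-resp x≈ y≈ xy = xy ∘ proj₂ (dist-cong x≈ y≈)

  near-halves : ∀ {q x y z} → near (half q) x y → near (half q) y z → near q x z
  near-halves {q} {x} {z = z} xy yz =
    subst (λ r → near r x z) (half+half≡ q) (near-trans xy yz)

  near⇒< : ∀ {q r x y} → near q x y → q ∈ cut r → dist x y <ᴿ r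
  near⇒< xy q∈ = _ , xy , q∈

  <⇒near : ∀ {q x y} → dist x y <ᴿ fromℚ q → near q x y
  <⇒near (p , xy , p<q) = near-mono (ℚ.<⇒≤ p<q) xy

  int : Pred Carrier ℓ → Pred Carrier (c ⊔ ℓ)
  int P x = ∃[ q ] 0ℚ ℚ.< q × near q x ⊆ P

  open⇒⊆int : ∀ (P : Pred Carrier ℓ) → MetricOpen dist P → P ⊆ int P
  open⇒⊆int P oP x∈ =
    let r , 0<r , h = oP x∈ ; q , 0<q , q∈ = ∃-pos∈cut {r} 0<r
    in q , 0<q , λ xy → h (near⇒< {r = r} xy q∈)

  ⊆int⇒open : ∀ (P : Pred Carrier ℓ) → P ⊆ int P → MetricOpen dist P
  ⊆int⇒open P P⊆ x∈ =
    let q , 0<q , h = P⊆ x∈ in fromℚ q , 0ᴿ<fromℚ 0<q , h ∘ <⇒near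

  int⊆ : {P : Pred Carrier ℓ} → int P ⊆ P
  int⊆ (q , 0<q , h) = h (near-refl (ℚ.<⇒≤ 0<q) (Setoid.refl setoid))

  int-open : (P : Pred Carrier ℓ) → MetricOpen dist (int P)
  int-open P = ⊆int⇒open (int P) λ (q , 0<q , h) →
    half q , half-pos 0<q , λ xy → half q , half-pos 0<q , λ yz → h (near-halves xy yz)

  IsDenseSequence : (ℕ → Maybe Carrier) → Set c
  IsDenseSequence s =
    ∀ x {q} → 0ℚ ℚ.< q → ∃[ n ] ∃[ y ] s n ≡ just y × near q x y

  -- A topology induced by a metric may be given on a setoid with another proof that `_≈_` is an
  -- equivalence than the one inside that metric, hence the parameter `E`.
  setoidWith : IsEquivalence _≈_ → Setoid c e
  setoidWith E = record { isEquivalence = E }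

  module _ {E : IsEquivalence _≈_} (T : Topology (setoidWith E) c o) where
    open Topology T

    separable⇒denseSequence : (∀ U → MetricOpen dist U → IsOpen U) →
      IsSeparable → ∃[ s ] IsDenseSequence s
    separable⇒denseSequence open⇒ (D , (s , s-D) , dense) = s , λ x {q} 0<q →
      let y , y∈int , y∈D = dense (int (near q x)) (open⇒ _ (int-open (near q x))) (x , q , 0<q , id)
          n , z , s≡ , y≈z = s-D y y∈D
      in n , z , s≡ , near-resp (Setoid.refl setoid) y≈z (int⊆ y∈int)

    denseSequence⇒separable : (∀ U → IsOpen U → MetricOpen dist U) →
      ∀ {s} → IsDenseSequence s → IsSeparable
    denseSequence⇒separable ⇒open {s} s-dense =
        (λ y → ∃[ n ] s n ≡ just y)
      , (s , λ y (n , s≡) → n , y , s≡ , Setoid.refl setoid)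
      , λ U oU (x , x∈) →
          let q , 0<q , h = open⇒⊆int U (⇒open U oU) x∈
              n , y , s≡ , xy = s-dense x 0<q
          in y , h xy , n , s≡

-- Excluded middle: resizing of propositions and least witnesses.

module Classical (em : ∀ {l} → ExcludedMiddle l) where

  dne : {P : Set ℓ} → ¬ ¬ P → P
  dne = decidable-stable em

  -- `True` keeps only the answer of `em`, so every proposition has an equivalent at every level.
  -- This brings suprema down to the level of cuts, and subsets defined by large quantifiers down to
  -- the level of the topology.
  resize : Set ℓ → Set ℓ′
  resize P = Lift _ (True (em {P = P}))

  resize⁺ : {P : Set ℓ} → P → resize {ℓ′ = ℓ′} P
  resize⁺ = lift ∘ fromWitness

  resize⁻ : {P : Set ℓ} → resize {ℓ′ = ℓ′} P → P
  resize⁻ = toWitness ∘ Level.lower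

  abstract
    least : (P : Pred ℕ ℓ) → Satisfiable P → ∃[ n ] n ∈ P × (∀ {m} → m ℕ.< n → m ∉ P)
    least P (n , n∈) = go n (<-wellFounded n) n∈
      where
      go : ∀ n → Acc ℕ._<_ n → n ∈ P → ∃[ n ] n ∈ P × (∀ {m} → m ℕ.< n → m ∉ P)
      go n (acc rs) n∈ with em {P = ∃[ m ] m ℕ.< n × m ∈ P}
      ... | yes (m , m<n , m∈) = go m (rs m<n) m∈
      ... | no ∄               = n , n∈ , λ m<n m∈ → ∄ (_ , m<n , m∈)

  -- Closed and Fσ subsets of a metric space.

  module Space (M : MetricSpace c e) where
    open MetricSpace M
    open Near M public
    open Topology (metricTopology M) public

    closed-resp-≈ : ∀ C → IsClosed C → C Respects _≈_
    closed-resp-≈ C oC x≈y x∈ =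
      dne λ y∉ → open-resp-≈ {∁ C} oC (Setoid.sym setoid x≈y) y∉ x∈

    closed-∩ : ∀ C D → IsClosed C → IsClosed D → IsClosed (C ∩ D)
    closed-∩ C D oC oD = ⊆int⇒open (∁ (C ∩ D)) λ {x} ∉C∩D → case em {P = x ∈ C} of λ where
      (no x∉) → let q , 0<q , h = open⇒⊆int (∁ C) oC x∉ in q , 0<q , λ {y} xy y∈ → h {y} xy (proj₁ y∈)
      (yes x∈) →
        let q , 0<q , h = open⇒⊆int (∁ D) oD (λ x∈D → ∉C∩D (x∈ , x∈D)) in q , 0<q , λ {y} xy y∈ → h {y} xy (proj₂ y∈)

    ∁-closed : ∀ V → IsOpen V → IsClosed (∁ V)
    ∁-closed V = IsOpen-resp-≐ {V} ((λ x∈ x∉ → x∉ x∈) , dne)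

    ∅-closed : IsClosed (λ _ → Lift c ⊥)
    ∅-closed = ⊆int⇒open _ λ _ → 1ℚ , ℚ.positive⁻¹ 1ℚ , λ _ → Level.lower

    -- A distance above `q` is above some `r > q` as well, which leaves a ball of radius `r - q`
    -- outside by the triangle inequality.
    near-closed : ∀ q x → IsClosed (λ y → Lift c (near q x y))
    near-closed q x = ⊆int⇒open _ λ {y} ¬xy →
      let r , q<r , r∈ = noMax (dist x y) (dne (¬xy ∘ lift))
          s , 0<s , q+s≡r = <⇒∃+ q<r
      in s , 0<s , λ {z} yz (lift xz) →
           subst (λ t → near t x y) q+s≡r (near-trans xz (near-sym yz)) r∈

    -- The points at distance at least 1/(k+1) from the complement of V.
    inner : ℕ → Pred Carrier ℓ → Pred Carrier (c ⊔ ℓ)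
    inner k V x = ∀ {y} → y ∉ V → ∀ {q} → q ℚ.< 1/1+ k → ¬ near q x y

    -- The strict inequality `q < 1/1+ k` leaves room to move `x` by `r - q`, with `r` chosen
    -- strictly in between.
    inner-closed : ∀ k (V : Pred Carrier c) → IsClosed (inner k V)
    inner-closed k V = ⊆int⇒open (∁ (inner k V)) λ {x} x∉ →
      let (y , y∉ , q , q<k , xy) = dne {P = ∃[ y ] y ∉ V × ∃[ q ] q ℚ.< 1/1+ k × near q x y}
            λ ∄ → x∉ λ y∉ q<k xy → ∄ (_ , y∉ , _ , q<k , xy)
          r , q<r , r<k = ℚ.<-dense q<k
          s , 0<s , q+s≡r = <⇒∃+ q<r
      in s , 0<s , λ {z} xz z∈ → z∈ y∉ r<k
           (subst (λ t → near t z y) (trans (ℚ.+-comm s q) q+s≡r) (near-trans (near-sym xz) xy))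

    inner⊆ : ∀ k {V : Pred Carrier ℓ} → inner k V ⊆ V
    inner⊆ k x∈ = dne λ x∉ → x∈ x∉ (1/1+-pos k) (near-refl ℚ.≤-refl (Setoid.refl setoid))

    open⊆⋃inner : ∀ V → IsOpen V → V ⊆ ⋃ ℕ (λ k → inner k V)
    open⊆⋃inner V oV x∈ =
      let q , 0<q , h = open⇒⊆int V oV x∈ ; k , k≤q = archimedean 0<q
      in k , λ y∉ r<k xy → y∉ (h (near-mono (ℚ.≤-trans (ℚ.<⇒≤ r<k) k≤q) xy))

    Fσ-resp-≐ : {P : Pred Carrier ℓ} {Q : Pred Carrier ℓ′} → P ≐ Q → IsFσ P → IsFσ Q
    Fσ-resp-≐ (P⊆Q , Q⊆P) (C , oC , P⊆ , ⊆P) = C , oC , P⊆ ∘ Q⊆P , P⊆Q ∘ ⊆P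

    closed⇒Fσ : ∀ C → IsClosed C → IsFσ C
    closed⇒Fσ C oC = (λ _ → C) , (λ _ → oC) , (0 ,_) , proj₂

    open⇒Fσ : ∀ V → IsOpen V → IsFσ V
    open⇒Fσ V oV = (λ k → inner k V) , (λ k → inner-closed k V)
      , open⊆⋃inner V oV , λ (k , x∈) → inner⊆ k x∈

    Fσ-⋃ : {P : ℕ → Pred Carrier ℓ} → (∀ n → IsFσ (P n)) → IsFσ (⋃ ℕ P)
    Fσ-⋃ {P = P} F = (λ n → let a , b = unpair n in proj₁ (F a) b)
      , (λ n → let a , b = unpair n in proj₁ (proj₂ (F a)) b)
      , (λ {x} (a , x∈) →
          let b , x∈C = proj₁ (proj₂ (proj₂ (F a))) x∈ ; n , n≡ = unpair-surjective a b
          in n , subst (λ (a , b) → x ∈ proj₁ (F a) b) (sym n≡) x∈C)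
      , λ (n , x∈) → let a , b = unpair n in a , proj₂ (proj₂ (proj₂ (F a))) (b , x∈)

    Fσ-∩ : {P : Pred Carrier ℓ} {Q : Pred Carrier ℓ′} → IsFσ P → IsFσ Q → IsFσ (P ∩ Q)
    Fσ-∩ (C , oC , P⊆ , ⊆P) (D , oD , Q⊆ , ⊆Q) =
        (λ n → let a , b = unpair n in C a ∩ D b)
      , (λ n → let a , b = unpair n in closed-∩ (C a) (D b) (oC a) (oD b))
      , (λ {x} (x∈P , x∈Q) →
          let a , x∈C = P⊆ x∈P ; b , x∈D = Q⊆ x∈Q ; n , n≡ = unpair-surjective a b
          in n , subst (λ (a , b) → x ∈ C a ∩ D b) (sym n≡) (x∈C , x∈D))
      , λ (n , x∈C , x∈D) → ⊆P (_ , x∈C) , ⊆Q (_ , x∈D)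

    -- Each `n` contributes its fibre or the empty set, according to whether `n ∈ P`. A function
    -- factoring through such an `i` is therefore Baire class one whatever its values.
    Fσ-fibres : {i : Carrier → ℕ} → (∀ n → IsFσ (λ x → i x ≡ n)) →
                (P : Pred ℕ ℓ) → IsFσ (λ x → i x ∈ P)
    Fσ-fibres {i = i} F P = Fσ-resp-≐
      ((λ (n , ix≡n , n∈) → subst P (sym ix≡n) n∈) , λ ix∈ → _ , refl , ix∈)
      (Fσ-⋃ {P = λ n x → i x ≡ n × n ∈ P} λ n → case em {P = n ∈ P} of λ where
        (yes n∈) → Fσ-resp-≐ ((_, n∈) , proj₁) (F n)
        (no n∉)  → Fσ-resp-≐ ((λ ()) , λ (_ , n∈) → contradiction n∈ n∉) (closed⇒Fσ _ ∅-closed))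

    below : (ℕ → Pred Carrier ℓ) → ℕ → Pred Carrier ℓ
    below P n x = ∀ {m} → m ℕ.< n → x ∈ P m

    below-split : {P : ℕ → Pred Carrier ℓ} → ∀ n → P n ∩ below P n ⊆ below P (ℕ.suc n)
    below-split {P = P} n {x} (x∈ , h) {m} m<1+n with ℕ.m≤n⇒m<n∨m≡n (ℕ.s≤s⁻¹ m<1+n)
    ... | inj₁ m<n  = h m<n
    ... | inj₂ refl = x∈

    below-open : {P : ℕ → Pred Carrier c} → (∀ n → IsOpen (P n)) → ∀ n → IsOpen (below P n)
    below-open {P} oP ℕ.zero    = ⊆int⇒open (below P 0) λ _ → 1ℚ , ℚ.positive⁻¹ 1ℚ , λ _ ()
    below-open {P} oP (ℕ.suc n) = IsOpen-resp-≐
      {P n ∩ below P n} {below P (ℕ.suc n)}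
      (below-split {P = P} n , λ h → h ℕ.≤-refl , λ m<n → h (ℕ.m≤n⇒m≤1+n m<n))
      (∩-open {P n} {below P n} (oP n) (below-open oP n))

    below-Fσ : {P : ℕ → Pred Carrier ℓ} → (∀ n → IsFσ (P n)) → ∀ n → IsFσ (below P n)
    below-Fσ F ℕ.zero = Fσ-resp-≐ ((λ _ ()) , λ _ ∅ → Level.lower ∅)
      (closed⇒Fσ _ (∁-closed (λ _ → Lift c ⊥) (⊆int⇒open (λ _ → Lift c ⊥) λ ())))
    below-Fσ {P = P} F (ℕ.suc n) = Fσ-resp-≐
      {P = P n ∩ below P n} {Q = below P (ℕ.suc n)}
      (below-split {P = P} n , λ h → h ℕ.≤-refl , λ m<n → h (ℕ.m≤n⇒m≤1+n m<n))
      (Fσ-∩ (F n) (below-Fσ F n))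

    -- Turns a closed cover into a countable partition, the fibres of `index`, at the price of Fσ
    -- pieces instead of closed ones.
    module FirstIndex {G : ℕ → Pred Carrier c} (G-closed : ∀ n → IsClosed (G n))
                      (cover : Universal (⋃ ℕ G)) where

      index : Carrier → ℕ
      index x = proj₁ (least (λ n → x ∈ G n) (cover x))

      ∈-index : ∀ x → x ∈ G (index x)
      ∈-index x = proj₁ (proj₂ (least (λ n → x ∈ G n) (cover x)))

      ∉-before : ∀ x → x ∈ below (λ m → ∁ (G m)) (index x)
      ∉-before x = proj₂ (proj₂ (least (λ n → x ∈ G n) (cover x)))

      index-unique : ∀ {x n} → x ∈ G n → x ∈ below (λ m → ∁ (G m)) n → index x ≡ n
      index-unique {x} {n} x∈ x∉ with ℕ.<-cmp (index x) n
      ... | tri< i<n _ _ = contradiction (∈-index x) (x∉ i<n)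
      ... | tri≈ _ i≡n _ = i≡n
      ... | tri> _ _ n<i = contradiction x∈ (∉-before x n<i)

      index-cong : ∀ {x y} → x ≈ y → index x ≡ index y
      index-cong {x} {y} x≈y = index-unique
        (closed-resp-≈ (G _) (G-closed _) (Setoid.sym setoid x≈y) (∈-index y))
        λ m<n x∈ → ∉-before y m<n (closed-resp-≈ (G _) (G-closed _) x≈y x∈)

      -- The fibre is a closed set minus finitely many closed sets, and open sets are Fσ in a metric
      -- space.
      index-Fσ : ∀ n → IsFσ (λ x → index x ≡ n)
      index-Fσ n = Fσ-resp-≐ {P = G n ∩ below (λ m → ∁ (G m)) n}
        ((λ (x∈ , x∉) → index-unique x∈ x∉) , λ { {x} refl → ∈-index x , ∉-before x })
        (Fσ-∩ (closed⇒Fσ (G n) (G-closed n)) (open⇒Fσ _ (below-open {λ m → ∁ (G m)} G-closed n)))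

    -- Lindelöf's theorem for a hereditary property `Q` of sets. The candidates are the balls of
    -- radius `1/1+ k` around the dense sequence. If `near q x` has `Q`, take `1/1+ k ≤ half q` and
    -- a dense `y` within `1/1+ k` of `x`: the ball around `y` contains `x` and lies in `near q x`,
    -- so it has `Q` too.
    lindelöf : ∀ {s} → IsDenseSequence s → (Q : Pred (Pred Carrier 0ℓ) ℓ) →
      (∀ {S S′} → S ⊆ S′ → S′ ∈ Q → S ∈ Q) → ∅ ∈ Q →
      (P : Pred Carrier ℓ′) → (∀ {x} → x ∈ P → ∃[ q ] 0ℚ ℚ.< q × near q x ∈ Q) →
      ∃[ S ] (∀ n → S n ∈ Q) × P ⊆ ⋃ ℕ S
    lindelöf {s = s} dense Q Q-anti Q-∅ P local =
      (λ n → let j , k = unpair n in pick (s j) k em) ,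
      (λ n → let j , k = unpair n in pick∈Q (s j) k em) ,
      λ {x} x∈ →
        let q , 0<q , Qx = local x∈
            k , k≤ = archimedean (half-pos 0<q)
            j , y , sj≡ , xy = dense x (1/1+-pos k)
            n , n≡ = unpair-surjective j k
            ball⊆ : near (1/1+ k) y ⊆ near q x
            ball⊆ yz = near-halves (near-mono k≤ xy) (near-mono k≤ yz)
            x∈pick = λ dec → ∈-pick dec (Q-anti {near (1/1+ k) y} ball⊆ Qx) (near-sym xy)
        in n , subst (λ (j , k) → x ∈ pick (s j) k em) (sym n≡)
                 (subst (λ m → x ∈ pick m k em) (sym sj≡) (x∈pick em))
      where
      ball : Maybe Carrier → ℕ → Pred Carrier 0ℓ
      ball (just y) k = near (1/1+ k) y
      ball nothing  k = ∅

      -- A candidate without `Q` is replaced by `∅`. The decision is an argument so that `∈-pick`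
      -- can match on it.
      pick : ∀ m k → Dec (ball m k ∈ Q) → Pred Carrier 0ℓ
      pick m k (yes _) = ball m k
      pick m k (no _)  = ∅

      pick∈Q : ∀ m k dec → pick m k dec ∈ Q
      pick∈Q m k (yes Qm) = Qm
      pick∈Q m k (no _)   = Q-∅

      ∈-pick : ∀ {y k x} dec → near (1/1+ k) y ∈ Q → near (1/1+ k) y x →
               x ∈ pick (just y) k dec
      ∈-pick (yes _) _  yx = yx
      ∈-pick (no ¬Q) Qy _  = contradiction Qy ¬Q

  -- The diameter is the union of the cut of 0 with those of all distances, resized to level 0.
  -- Including 0 settles the case of empty `P`, and `q`, which bounds every distance, separates the
  -- supremum from `ε`.
  diam-< : (M : MetricSpace c e) (P : Pred (MetricSpace.Carrier M) ℓ) →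
    ∀ {q ε} → 0ℚ ℚ.< q → q ∈ cut ε → (∀ {y y′} → y ∈ P → y′ ∈ P → y′ ∈ Near.near M q y) →
    diam[ M ] P < ε
  diam-< M P {q} 0<q q∈ε bounded =
    r , ((inj₁ , λ y∈ y′∈ p∈ → inj₂ (resize⁺ (_ , _ , y∈ , y′∈ , p∈))) , r-least) , q , q∉r , q∈ε
    where
    open MetricSpace M

    InSup : ℚ → Set _
    InSup p = ∃[ y ] ∃[ y′ ] y ∈ P × y′ ∈ P × p ∈ cut (dist y y′)

    q∉r : ¬ (q ℚ.< 0ℚ ⊎ resize {ℓ′ = 0ℓ} (InSup q))
    q∉r (inj₁ q<0) = ℚ.<-irrefl refl (ℚ.<-trans 0<q q<0)
    q∉r (inj₂ q∈)  = let y , y′ , y∈ , y′∈ , q∈d = resize⁻ q∈ in bounded y∈ y′∈ q∈d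

    r : ℝ
    r = record
      { cut       = λ p → p ℚ.< 0ℚ ⊎ resize (InSup p)
      ; inhabited = let p , p∈ = inhabited 0ᴿ in p , inj₁ p∈
      ; proper    = q , q∉r
      ; lower     = λ where
          p<p′ (inj₁ p′<0) → inj₁ (ℚ.<-trans p<p′ p′<0)
          p<p′ (inj₂ p′∈)  →
            let y , y′ , y∈ , y′∈ , p′∈d = resize⁻ p′∈
            in inj₂ (resize⁺ (y , y′ , y∈ , y′∈ , lower (dist y y′) p<p′ p′∈d))
      ; noMax     = λ where
          (inj₁ p<0) → let p′ , p<p′ , p′<0 = ℚ.<-dense p<0 in p′ , p<p′ , inj₁ p′<0
          (inj₂ p∈)  →
            let y , y′ , y∈ , y′∈ , p∈d = resize⁻ p∈
                p′ , p<p′ , p′∈d = noMax (dist y y′) p∈d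
            in p′ , p<p′ , inj₂ (resize⁺ (y , y′ , y∈ , y′∈ , p′∈d))
      }

    r-least : ∀ s → 0ᴿ ≤ᴿ s × (∀ {y y′} → y ∈ P → y′ ∈ P → dist y y′ ≤ᴿ s) → r ≤ᴿ s
    r-least s (0≤s , d≤s) (inj₁ p<0) = 0≤s p<0
    r-least s (0≤s , d≤s) (inj₂ p∈)  =
      let y , y′ , y∈ , y′∈ , p∈d = resize⁻ p∈ in d≤s y∈ y′∈ p∈d

  -- A finer separable metric built from countably many labels.

  -- The labels i make the metric finer: dist′ = max (dist , sup { 1/(n+1) | i n x ≢ i n y }).
  module Refine (M : MetricSpace c e) (i : ℕ → MetricSpace.Carrier M → ℕ)
                (i-cong : ∀ n {x y} → MetricSpace._≈_ M x y → i n x ≡ i n y) where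
    open MetricSpace M
    open IsGeneralMetric isMetric
      using (≈-isEquivalence; nonNegative; ≈⇒0; 0⇒≈; triangle)
      renaming (cong to dist-cong; sym to dist-sym)

    dist′ : Carrier → Carrier → ℝ
    dist′ x y = record
      { cut       = λ q → q ∈ cut (dist x y) ⊎ ∃[ n ] q ℚ.< 1/1+ n × i n x ≢ i n y
      ; inhabited = let q , q∈ = inhabited (dist x y) in q , inj₁ q∈
      ; proper    =
          let q , q∉ = proper (dist x y) in
          -- No label contributes more than `1/1+ 0`, which is 1.
          q ℚ.⊔ 1ℚ , λ where
            (inj₁ q⊔1∈)          → q∉ (cut-≤ (dist x y) (ℚ.p≤p⊔q q 1ℚ) q⊔1∈)
            (inj₂ (n , q⊔1<n , _)) → ℚ.<-irrefl refl
              (ℚ.<-≤-trans q⊔1<n (ℚ.≤-trans (1/1+-anti {0} ℕ.z≤n) (ℚ.p≤q⊔p q 1ℚ)))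
      ; lower     = λ where
          p<q (inj₁ q∈)            → inj₁ (lower (dist x y) p<q q∈)
          p<q (inj₂ (n , q<n , i≢)) → inj₂ (n , ℚ.<-trans p<q q<n , i≢)
      ; noMax     = λ where
          (inj₁ q∈)            → let r , q<r , r∈ = noMax (dist x y) q∈ in r , q<r , inj₁ r∈
          (inj₂ (n , q<n , i≢)) → let r , q<r , r<n = ℚ.<-dense q<n in r , q<r , inj₂ (n , r<n , i≢)
      }

    dist′-nonNegative : ∀ {x y} → 0ᴿ ≤ᴿ dist′ x y
    dist′-nonNegative p<0 = inj₁ (nonNegative p<0)

    dist′-mono : ∀ {x y u v} → dist x y ≤ᴿ dist u v → (∀ n → i n x ≢ i n y → i n u ≢ i n v) →
                 dist′ x y ≤ᴿ dist′ u v
    dist′-mono d≤ i≢ (inj₁ q∈)            = inj₁ (d≤ q∈)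
    dist′-mono d≤ i≢ (inj₂ (n , q<n , ≢)) = inj₂ (n , q<n , i≢ n ≢)

    -- If the `n`-th labels of `x` and `z` differ, that of `y` differs from one of them, so a single
    -- summand is already large enough.
    dist′-triangle : ∀ x y z → dist′ x z ≤ᴿ dist′ x y +ᴿ dist′ y z
    dist′-triangle x y z (inj₁ q∈) =
      let p , r , p∈ , r∈ , q≡ = triangle x y z q∈ in p , r , inj₁ p∈ , inj₁ r∈ , q≡
    dist′-triangle x y z (inj₂ (n , q<n , i≢)) with i n x ℕ.≟ i n y
    ... | no ≢    = x≤x+y (dist′ x y) (dist′ y z) (dist′-nonNegative {y} {z}) (inj₂ (n , q<n , ≢))
    ... | yes i≡ = x≤y+x (dist′ y z) (dist′ x y) (dist′-nonNegative {x} {y})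
                     (inj₂ (n , q<n , λ i≡′ → i≢ (trans i≡ i≡′)))

    M′ : MetricSpace _ _
    M′ = record
      { Carrier  = Carrier
      ; _≈_      = _≈_
      ; dist     = dist′
      ; isMetric = record
        { isSemiMetric = record
          { isQuasiSemiMetric = record
            { isPreMetric = record
              { isProtoMetric = record
                { isPartialOrder  = ≤ᴿ-isPartialOrder
                ; ≈-isEquivalence = ≈-isEquivalence
                ; cong            = λ {x} {y} {u} {v} x≈y u≈v →
                    let ≤ , ≥ = dist-cong x≈y u≈v in
                      dist′-mono {x} {u} {y} {v} ≤ (λ n ≢ i≡ → ≢ (trans (i-cong n x≈y)
                        (trans i≡ (sym (i-cong n u≈v)))))
                    , dist′-mono {y} {v} {x} {u} ≥ (λ n ≢ i≡ → ≢ (trans (sym (i-cong n x≈y))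
                        (trans i≡ (i-cong n u≈v))))
                ; nonNegative     = λ {x} {y} → dist′-nonNegative {x} {y}
                }
              ; ≈⇒0 = λ {x} {y} x≈y →
                  (λ { (inj₁ q∈)            → proj₁ (≈⇒0 x≈y) q∈
                     ; (inj₂ (n , _ , i≢)) → contradiction (i-cong n x≈y) i≢ })
                , dist′-nonNegative {x} {y}
              }
            ; 0⇒≈ = λ d′≈0 → 0⇒≈ ((λ q∈ → proj₁ d′≈0 (inj₁ q∈)) , nonNegative)
            }
          ; sym = λ x y →
              dist′-mono {x} {y} {y} {x} (proj₁ (dist-sym x y)) (λ n ≢ → ≢ ∘ sym)
            , dist′-mono {y} {x} {x} {y} (proj₂ (dist-sym x y)) (λ n ≢ → ≢ ∘ sym)
          }
        ; triangle = dist′-triangle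
        }
      }

    private
      module S  = Space M
      module S′ = Space M′

    near′⁺ : ∀ {q x y} → S.near q x y → (∀ n → i n x ≢ i n y → 1/1+ n ℚ.≤ q) → S′.near q x y
    near′⁺ xy i≢ (inj₁ q∈)            = xy q∈
    near′⁺ xy i≢ (inj₂ (n , q<n , ≢)) = ℚ.<-irrefl refl (ℚ.<-≤-trans q<n (i≢ n ≢))

    near′⇒≡ : ∀ {q x y} n → q ℚ.< 1/1+ n → S′.near q x y → i n x ≡ i n y
    near′⇒≡ n q<n xy = dne λ ≢ → xy (inj₂ (n , q<n , ≢))

    finer : ∀ V → S.IsOpen V → S′.IsOpen V
    finer V oV = S′.⊆int⇒open V λ x∈ →
      let q , 0<q , h = S.open⇒⊆int V oV x∈ in q , 0<q , λ xy → h (xy ∘ inj₁)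

    private
      -- One number for the first `k` labels of `x`, decoded by iterating `unpair`.
      code : ℕ → Carrier → ℕ
      code ℕ.zero    x = 0
      code (ℕ.suc k) x = proj₁ (unpair-surjective (i k x) (code k x))

      code-≡ : ∀ k {x y} → code k x ≡ code k y → ∀ {n} → n ℕ.< k → i n x ≡ i n y
      code-≡ (ℕ.suc k) {x} {y} eq n<1+k
        with ℕ.m≤n⇒m<n∨m≡n (ℕ.s≤s⁻¹ n<1+k) | pair-≡
        where
        pair-≡ : (i k x , code k x) ≡ (i k y , code k y)
        pair-≡ = trans (sym (proj₂ (unpair-surjective (i k x) (code k x))))
          (trans (cong unpair eq) (proj₂ (unpair-surjective (i k y) (code k y))))
      ... | inj₁ n<k  | ≡ = code-≡ k (cong proj₂ ≡) n<k
      ... | inj₂ refl | ≡ = cong proj₁ ≡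

    -- Every `s j`, precision `k` and code `m` select one point within `1/1+ k` of `s j` whose first
    -- `k` labels have code `m`, if there is one. For `s j` close to `x` and `m = code k x`, `x`
    -- itself shows that there is one. The selected point agrees with `x` on the first `k` labels,
    -- and the later labels contribute at most `1/1+ k`.
    refine-dense : ∀ {s} → S.IsDenseSequence s → ∃[ s′ ] S′.IsDenseSequence s′
    refine-dense {s} dense = (λ n → toMaybe n (point n)) , λ x {q} 0<q →
      let k , k≤ = archimedean (half-pos 0<q)
          j , z , sj≡ , xz = dense x (1/1+-pos k)
          n₁ , n₁≡ = unpair-surjective k (code k x)
          n , n≡ = unpair-surjective j n₁
          P-x : P n x
          P-x = subst (λ (j , m) → near? (s j) (unpair m) x) (sym n≡)
                  (subst (λ p → near? (s j) p x) (sym n₁≡)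
                    (subst (λ m → near? m (k , code k x) x) (sym sj≡) (S.near-sym xz , refl)))
          y , point≡ , P-y = toMaybe-just n (point n) P-x
          zy , code≡ = subst (λ m → near? m (k , code k x) y) sj≡
                  (subst (λ p → near? (s j) p y) n₁≡
                    (subst (λ (j , m) → near? (s j) (unpair m) y) n≡ P-y))
      in n , y , point≡
       , near′⁺ (S.near-halves (S.near-mono k≤ xz) (S.near-mono k≤ zy))
           λ m i≢ → case m ℕ.<? k of λ where
             (yes m<k) → contradiction (code-≡ k (sym code≡) m<k) i≢
             (no m≮k)  → ℚ.≤-trans (1/1+-anti (ℕ.≮⇒≥ m≮k))
                           (ℚ.≤-trans k≤ (ℚ.<⇒≤ (half-< 0<q)))
      where
      near? : Maybe Carrier → ℕ × ℕ → Pred Carrier 0ℓ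
      near? (just z) (k , m) y = S.near (1/1+ k) z y × code k y ≡ m
      near? nothing  _       y = ⊥

      P : ℕ → Pred Carrier 0ℓ
      P n = let j , m = unpair n in near? (s j) (unpair m)

      point : ∀ n → Dec (∃[ y ] P n y)
      point n = em

      toMaybe : ∀ n → Dec (∃[ y ] P n y) → Maybe Carrier
      toMaybe n (yes (y , _)) = just y
      toMaybe n (no _)        = nothing

      toMaybe-just : ∀ n {x} (dec : Dec (∃[ y ] P n y)) → P n x →
                     ∃[ y ] toMaybe n dec ≡ just y × P n y
      toMaybe-just n (yes (y , P-y)) _   = y , refl , P-y
      toMaybe-just n (no ∄)          P-x = contradiction (_ , P-x) ∄

    module _ (i-Fσ : ∀ n m → S.IsFσ (λ x → i n x ≡ m)) where

      -- A label of index at least `k` contributes at most `1/1+ k ≤ q`, so inside the old ball only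
      -- the first `k` labels impose conditions.
      near′-Fσ : ∀ {q} x → 0ℚ ℚ.< q → S.IsFσ (S′.near q x)
      near′-Fσ {q} x 0<q = S.Fσ-resp-≐ {P = (λ y → Lift c (S.near q x y)) ∩ S.below Agree k}
        ( (λ (lift xy , agree) → near′⁺ xy λ n i≢ → case n ℕ.<? k of λ where
            (yes n<k) → agree n<k i≢
            (no n≮k)  → ℚ.≤-trans (1/1+-anti (ℕ.≮⇒≥ n≮k)) k≤q)
        , λ xy → lift (xy ∘ inj₁) , λ {n} _ i≢ → ℚ.≮⇒≥ λ q<n → i≢ (near′⇒≡ n q<n xy))
        (S.Fσ-∩ (S.closed⇒Fσ _ (S.near-closed q x))
          (S.below-Fσ {P = Agree} (λ n → S.Fσ-fibres (i-Fσ n) λ m → i n x ≢ m → 1/1+ n ℚ.≤ q) k))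
        where
        k = proj₁ (archimedean 0<q)
        k≤q = proj₂ (archimedean 0<q)
        Agree : ℕ → Pred Carrier 0ℓ
        Agree n y = i n x ≢ i n y → 1/1+ n ℚ.≤ q

      open′⇒Fσ : ∀ {s′} → S′.IsDenseSequence s′ → ∀ V → S′.IsOpen V → S.IsFσ V
      open′⇒Fσ dense′ V oV =
        -- Being Fσ is not hereditary; lying inside some Fσ subset `W` of `V` is, and the sets `W`
        -- obtained have union `V`.
        let S , Q , V⊆ = S′.lindelöf dense′
              (λ S → Σ[ W ∈ Pred Carrier 0ℓ ] S.IsFσ W × S ⊆ W × W ⊆ V)
              (λ S⊆ (W , FW , S′⊆W , W⊆) → W , FW , (λ x∈ → S′⊆W (S⊆ x∈)) , W⊆)
              (∅ , S.Fσ-resp-≐ {P = λ _ → Lift c ⊥} ((λ ()) , λ ()) (S.closed⇒Fσ _ S.∅-closed)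
                 , id , λ ())
              V (λ {x} x∈ → let q , 0<q , h = S′.open⇒⊆int V oV x∈ in
                   q , 0<q , S′.near q x , near′-Fσ x 0<q , id , h)
        in S.Fσ-resp-≐ {P = ⋃ ℕ λ n → proj₁ (Q n)}
             ( (λ (n , x∈) → proj₂ (proj₂ (proj₂ (Q n))) x∈)
             , λ x∈ → let n , x∈S = V⊆ x∈ in n , proj₁ (proj₂ (proj₂ (Q n))) x∈S)
             (S.Fσ-⋃ λ n → proj₁ (proj₂ (Q n)))

  -- Families of functions and countable closed covers by sets of small oscillation.

  module Family (X : MetricSpace c e) (Y : MetricSpace c′ e′)
                (A : Pred (Func (MetricSpace.setoid X) (MetricSpace.setoid Y)) ℓ) where
    module X where
      open MetricSpace X public
      open Space X public
    module Y where
      open MetricSpace Y public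
      open Near Y public

    Small : ℚ → Pred X.Carrier ℓ′ → Set _
    Small q P = ∀ g → g ∈ A → ∀ {x y} → x ∈ P → y ∈ P → Y.near q (g ⟨$⟩ x) (g ⟨$⟩ y)

    -- The sets `G n` may stick out of `P`; this makes the property hereditary, as `lindelöf`
    -- requires.
    σSmall : ℚ → Pred X.Carrier ℓ′ → Set _
    σSmall q P = Σ[ G ∈ (ℕ → Pred X.Carrier c) ]
      (∀ n → X.IsClosed (G n)) × (∀ n → Small q (G n)) × P ⊆ ⋃ ℕ G

    SmallCovers : Set _
    SmallCovers = ∀ {q} → 0ℚ ℚ.< q → σSmall q U

    σSmall-⊆ : ∀ {q} {P : Pred X.Carrier a} {Q : Pred X.Carrier ℓ′} → P ⊆ Q → σSmall q Q → σSmall q P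
    σSmall-⊆ P⊆Q (G , oG , sG , Q⊆) = G , oG , sG , Q⊆ ∘ P⊆Q

    σSmall-closed : ∀ {q} C → X.IsClosed C → Small q C → σSmall q C
    σSmall-closed C oC sC = (λ _ → C) , (λ _ → oC) , (λ _ → sC) , (0 ,_)

    σSmall-∅ : ∀ {q} → σSmall q ∅
    σSmall-∅ = σSmall-⊆ {Q = λ _ → Lift c ⊥} (λ ())
      (σSmall-closed _ X.∅-closed λ _ _ ())

    σSmall-⋃ : ∀ {q} {P : ℕ → Pred X.Carrier ℓ′} → (∀ n → σSmall q (P n)) → σSmall q (⋃ ℕ P)
    σSmall-⋃ σP = (λ n → let a , b = unpair n in proj₁ (σP a) b)
      , (λ n → let a , b = unpair n in proj₁ (proj₂ (σP a)) b)
      , (λ n → let a , b = unpair n in proj₁ (proj₂ (proj₂ (σP a))) b)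
      , λ {x} (a , x∈) →
          let b , x∈G = proj₂ (proj₂ (proj₂ (σP a))) x∈ ; n , n≡ = unpair-surjective a b
          in n , subst (λ (a , b) → x ∈ proj₁ (σP a) b) (sym n≡) x∈G

    σSmall-∪ : ∀ {q} {P Q : Pred X.Carrier ℓ′} → σSmall q P → σSmall q Q → σSmall q (P ∪ Q)
    σSmall-∪ {q = q} {P} {Q} σP σQ = σSmall-⊆ {Q = ⋃ ℕ R} [ (0 ,_) , (1 ,_) ]′ (σSmall-⋃ σR)
      where
      R : ℕ → Pred X.Carrier _
      R ℕ.zero    = P
      R (ℕ.suc _) = Q
      σR : ∀ n → σSmall q (R n)
      σR ℕ.zero    = σP
      σR (ℕ.suc _) = σQ

    module _ {s} (dense : X.IsDenseSequence s) where

      σSmall-local : ∀ {q} (P : Pred X.Carrier ℓ′) →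
        (∀ {x} → x ∈ P → ∃[ r ] 0ℚ ℚ.< r × σSmall q (P ∩ X.near r x)) → σSmall q P
      σSmall-local {q = q} P local =
        let S , σS , P⊆ = X.lindelöf dense (λ S → σSmall q (P ∩ S))
              (λ S⊆ → σSmall-⊆ λ (x∈ , x∈S) → x∈ , S⊆ x∈S)
              (σSmall-⊆ proj₂ σSmall-∅) P local
        in σSmall-⊆ (λ x∈ → let n , x∈S = P⊆ x∈ in n , x∈ , x∈S) (σSmall-⋃ σS)

      equiBaire⇒smallCovers : EquiBaireClassOne X Y A → SmallCovers
      equiBaire⇒smallCovers equiBaire {q} 0<q =
        σSmall-⊆ {Q = ⋃ ℕ λ n x → (δ ⟨$⟩ x) ∈ V n} (λ {x} _ → x∈⋃ x) (σSmall-⋃ σV)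
        where
        δ = proj₁ (equiBaire (fromℚ q) (0ᴿ<fromℚ 0<q))
        δ-Baire = proj₁ (proj₂ (equiBaire (fromℚ q) (0ᴿ<fromℚ 0<q)))
        δ-small = proj₂ (proj₂ (equiBaire (fromℚ q) (0ᴿ<fromℚ 0<q)))

        V : ℕ → Pred (Setoid.Carrier ℝ₊*) (suc 0ℓ)
        V n r = Lift (suc 0ℓ) (1/1+ n ∈ cut (proj₁ r))

        V-open : ∀ n → Topology.IsOpen ℝ₊*-topology (V n)
        V-open n = (λ r → Lift (suc 0ℓ) (1/1+ n ∈ cut r))
          , (λ {x} (lift n∈) → let b , x<b = ∃-above x in
              fromℚ (1/1+ n) , b , (1/1+ n , ℚ.<-irrefl refl , n∈) , x<b
              , λ {y} (p , p≮ , p∈) _ → lift (cut-≤ y (ℚ.≮⇒≥ p≮) p∈))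
          , id , id

        x∈⋃ : ∀ x → x ∈ ⋃ ℕ λ n x → (δ ⟨$⟩ x) ∈ V n
        x∈⋃ x =
          let r , 0<r , r∈ = ∃-pos∈cut {proj₁ (δ ⟨$⟩ x)} (proj₂ (δ ⟨$⟩ x))
              n , n≤r = archimedean 0<r
          in n , lift (cut-≤ (proj₁ (δ ⟨$⟩ x)) n≤r r∈)

        σV : ∀ n → σSmall q (λ x → (δ ⟨$⟩ x) ∈ V n)
        σV n =
          let C , oC , V⊆ , ⊆V = δ-Baire (V n) (V-open n)
              r = 1/1+ n
          in σSmall-⊆ V⊆ (σSmall-⋃ λ k → σSmall-local (C k) λ {z} _ →
               -- Two points of such a ball are at distance at most `1/1+ n`, and this number lies
               -- in the cuts of `δ` at both points when they belong to `C k`.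
               half r , half-pos (1/1+-pos n)
               , σSmall-⊆ (λ (x∈ , zx) → x∈ , lift zx)
                   (σSmall-closed (C k ∩ λ x → Lift c (X.near (half r) z x))
                     (X.closed-∩ (C k) _ (oC k) (X.near-closed (half r) z))
                     λ g g∈ {x} {y} (x∈ , lift zx) (y∈ , lift zy) →
                       Y.<⇒near (δ-small x y
                         (X.near⇒< {r = proj₁ (δ ⟨$⟩ x) ⊓ᴿ proj₁ (δ ⟨$⟩ y)}
                           (X.near-halves (X.near-sym zx) zy)
                           (Level.lower (⊆V (k , x∈)) , Level.lower (⊆V (k , y∈))))
                         g g∈)))

    -- With m the first index such that x ∈ G m, the radius δ(x) is so small that the ball
    -- around x misses G 0, …, G (m - 1); so two points closer than δ have the same m.
    smallCovers⇒equiBaire : SmallCovers → EquiBaireClassOne X Y A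
    smallCovers⇒equiBaire covers ε 0<ε =
        record { to = value ∘ index ; cong = λ {x} {y} x≈y → value-cong {index x} {index y} (index-cong x≈y) }
      , (λ V _ → X.Fσ-fibres index-Fσ (λ n → value n ∈ V))
      , λ x y (p , xy , p<x , p<y) g g∈ →
          Y.near⇒< {r = ε} (G-small _ g g∈ (proj₁ (∈-index x))
            (subst (λ m → y ∈ G m) (sym (same x y p<x p<y xy)) (proj₁ (∈-index y)))) q∈ε
      where
      q = proj₁ (∃-pos∈cut {ε} 0<ε)
      q∈ε = proj₂ (proj₂ (∃-pos∈cut {ε} 0<ε))
      cover = covers (proj₁ (proj₂ (∃-pos∈cut {ε} 0<ε)))
      G = proj₁ cover
      G-closed = proj₁ (proj₂ cover)
      G-small = proj₁ (proj₂ (proj₂ cover))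
      module G = X.FirstIndex G-closed (λ x → proj₂ (proj₂ (proj₂ cover)) _)

      Before : ℕ → Pred X.Carrier c
      Before = X.below (λ m → ∁ (G m))

      Before-open : ∀ m → X.IsOpen (Before m)
      Before-open = X.below-open {λ m → ∁ (G m)} G-closed

      -- Membership in `H n` forces `m` to be the first index for `G`, with distance at least
      -- `1/1+ k` to the earlier sets. The index in this second closed cover thus encodes both `m`
      -- and a radius.
      H : ℕ → Pred X.Carrier c
      H n = let m , k = unpair n in G m ∩ X.inner k (Before m)

      H-closed : ∀ n → X.IsClosed (H n)
      H-closed n = let m , k = unpair n in
        X.closed-∩ (G m) (X.inner k (Before m)) (G-closed m) (X.inner-closed k (Before m))

      H-cover : Universal (⋃ ℕ H)
      H-cover x =
        let m = G.index x
            k , x∈ = X.open⊆⋃inner (Before m) (Before-open m) (G.∉-before x)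
            n , n≡ = unpair-surjective m k
        in n , subst (λ (m , k) → x ∈ G m ∩ X.inner k (Before m)) (sym n≡) (G.∈-index x , x∈)

      open X.FirstIndex H-closed H-cover

      m[_] k[_] : X.Carrier → ℕ
      m[ x ] = proj₁ (unpair (index x))
      k[ x ] = proj₂ (unpair (index x))

      value : ℕ → Setoid.Carrier ℝ₊*
      value n = let m , k = unpair n in fromℚ (1/1+ k) , 0ᴿ<fromℚ (1/1+-pos k)

      value-cong : ∀ {m n} → m ≡ n → proj₁ (value m) ≈ᴿ proj₁ (value n)
      value-cong refl = id , id

      -- If `m[ x ] < m[ y ]`, then `x` lies in a set preceding `G m[ y ]`, from which `y` keeps
      -- distance at least `1/1+ k[ y ]`, more than `p`.
      ≮ : ∀ x y {p} → p ℚ.< 1/1+ k[ y ] → X.near p x y → ¬ m[ x ] ℕ.< m[ y ]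
      ≮ x y p<y xy mx<my =
        proj₂ (∈-index y) (λ x∈ → x∈ mx<my (proj₁ (∈-index x))) p<y (X.near-sym xy)

      same : ∀ x y {p} → p ℚ.< 1/1+ k[ x ] → p ℚ.< 1/1+ k[ y ] → X.near p x y → m[ x ] ≡ m[ y ]
      same x y p<x p<y xy = ℕ.≤-antisym
        (ℕ.≮⇒≥ (≮ y x p<x (X.near-sym xy))) (ℕ.≮⇒≥ (≮ x y p<y xy))

    ClosedCovers : Set _
    ClosedCovers = ∀ ε → 0ᴿ <ᴿ ε →
      Σ[ G ∈ (ℕ → Pred X.Carrier c) ]
        (∀ m → X.IsClosed (G m)) × Universal (⋃ ℕ G) ×
        (∀ f → f ∈ A → ∀ m → diam[ Y ] image f (G m) < ε)

    smallCovers⇒closedCovers : SmallCovers → ClosedCovers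
    smallCovers⇒closedCovers covers ε 0<ε =
      let q , 0<q , q∈ε = ∃-pos∈cut {ε} 0<ε
          G , oG , sG , cover = covers 0<q
      in G , oG , (λ x → cover _) , λ f f∈ m → diam-< Y (image f (G m)) {ε = ε} 0<q q∈ε
           λ (x , x∈ , fx≈) (y , y∈ , fy≈) → Y.near-resp fx≈ fy≈ (sG m f f∈ x∈ y∈)

    closedCovers⇒smallCovers : ClosedCovers → SmallCovers
    closedCovers⇒smallCovers covers {q} 0<q =
      let G , oG , cover , diam = covers (fromℚ q) (0ᴿ<fromℚ 0<q)
      in G , oG , (λ m g g∈ {x} {y} x∈ y∈ →
           let r , ((_ , d≤r) , _) , p , p∉r , p<q = diam g g∈ m
           in Y.<⇒near (p , p∉r ∘ d≤r (x , x∈ , Setoid.refl Y.setoid) (y , y∈ , Setoid.refl Y.setoid) , p<q))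
       , λ _ → cover _

    FinerTopology : Set _
    FinerTopology = Σ[ τ ∈ Topology X.setoid c (suc 0ℓ ⊔ c) ]
        IsMetrizable τ × Topology.IsSeparable τ ×
        (∀ V → X.IsOpen V → Topology.IsOpen τ V) ×
        (∀ V → Topology.IsOpen τ V → X.IsFσ V) ×
        Equicontinuous τ Y A

    -- One cover, hence one label, is taken for each precision `1/1+ n`, so that a single metric
    -- serves all `ε` at once.
    smallCovers⇒finerTopology : ∀ {s} → X.IsDenseSequence s → SmallCovers → FinerTopology
    smallCovers⇒finerTopology dense covers =
        metricTopology M′
      , (dist′ , MetricSpace.isMetric M′ , λ V → mk⇔ id id)
      , S′.denseSequence⇒separable (metricTopology M′) (λ V → id) {proj₁ dense′} (proj₂ dense′)
      , finer
      , open′⇒Fσ (λ n m → I.index-Fσ n m) (proj₂ dense′)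
      , λ x ε 0<ε →
          let q , 0<q , q∈ε = ∃-pos∈cut {ε} 0<ε
              n , n≤q = archimedean 0<q
              -- As `r` is strictly below `1/1+ n`, points at new distance at most `r` share the
              -- `n`-th label and lie in one set of the `n`-th cover.
              r = half (1/1+ n)
          in S′.int (S′.near r x) , S′.int-open (S′.near r x) , (r , half-pos (1/1+-pos n) , id)
           , λ g g∈ y y∈ →
               let i≡ = near′⇒≡ n (half-< (1/1+-pos n)) (S′.int⊆ {P = S′.near r x} y∈)
               in Y.near⇒< {r = ε} (proj₁ (proj₂ (proj₂ (cover n))) _ g g∈ (I.∈-index n x)
                    (subst (λ m → y ∈ G n m) (sym i≡) (I.∈-index n y)))
                    (cut-≤ ε n≤q q∈ε)
      where
      cover = λ n → covers (1/1+-pos n)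
      G = λ n → proj₁ (cover n)
      module I (n : ℕ) =
        X.FirstIndex (proj₁ (proj₂ (cover n))) (λ x → proj₂ (proj₂ (proj₂ (cover n))) _)
      open Refine X I.index (λ n → I.index-cong n)
      module S′ = Space M′
      dense′ = refine-dense dense

    -- A `τ`-neighbourhood witnessing equicontinuity within `half q` is Fσ in `X`, and the closed
    -- sets composing it oscillate by at most `q`. Countably many such neighbourhoods suffice, by
    -- `lindelöf` for the metric `d` of `τ`.
    finerTopology⇒smallCovers : FinerTopology → SmallCovers
    finerTopology⇒smallCovers (τ , (d , d-isMetric , open⇔) , sep , _ , open⇒Fσ , equi) {q} 0<q =
      let s , dense = S.separable⇒denseSequence τ (λ V → Equivalence.from (open⇔ V)) sep
          S , σS , ⊆⋃ = S.lindelöf dense (σSmall q) σSmall-⊆ σSmall-∅ U λ {x} _ →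
            let V , oV , x∈ , V-small = equi x (fromℚ (half q)) (0ᴿ<fromℚ (half-pos 0<q))
                C , oC , V⊆ , ⊆V = open⇒Fσ V oV
                r , 0<r , ball⊆ = S.open⇒⊆int V (Equivalence.to (open⇔ V) oV) x∈
            in r , 0<r , σSmall-⊆ ball⊆ (C , oC , (λ n g g∈ y∈ z∈ → Y.near-halves
                 (Y.near-sym (Y.<⇒near (V-small g g∈ _ (⊆V (n , y∈)))))
                 (Y.<⇒near (V-small g g∈ _ (⊆V (n , z∈))))) , V⊆)
      in σSmall-⊆ ⊆⋃ (σSmall-⋃ σS)
      where
      M : MetricSpace _ _
      M = record { isMetric = d-isMetric }
      module S = Space M

    HasEquicontinuityPoints : Set _
    HasEquicontinuityPoints = ∀ F → X.IsClosed F → Satisfiable F →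
      ∃[ x ] EquicontinuousAt (subspace (metricTopology X) F) Y (restrict A F) x

    _↾_ : Func X.setoid Y.setoid → (F : Pred X.Carrier c) → Func (subsetoid X.setoid F) Y.setoid
    g ↾ F = record { to = λ z → g ⟨$⟩ proj₁ z ; cong = Func.cong g }

    ↾∈restrict : ∀ F {g} → g ∈ A → g ↾ F ∈ restrict A F
    ↾∈restrict F {g} g∈ = g , g∈ , λ _ → Setoid.refl Y.setoid

    -- ∁ C together with the interior of C relative to F is open and dense in F for closed C.
    smallCovers⇒equicontinuityPoints :
      (∀ F → X.IsClosed F → Topology.IsBaire (subspace (metricTopology X) F)) →
      SmallCovers → HasEquicontinuityPoints
    smallCovers⇒equicontinuityPoints baire covers F F-closed (z , z∈) = x , λ ε 0<ε →
      let q , 0<q , q∈ε = ∃-pos∈cut {ε} 0<ε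
          n , n≤q = archimedean 0<q
          m , x∈G = proj₂ (proj₂ (proj₂ (cover n))) {proj₁ x} _
          k , k≡ = unpair-surjective n m
          -- The generic point lies in every `V k`; being in `G n m`, it must fall into the relative
          -- interior.
          x∈int = case subst (λ (n , m) → proj₁ x ∈ ∁ (G n m) ∪ Int n m) k≡ (x∈ k) of λ where
            (inj₁ x∉G)   → contradiction x∈G x∉G
            (inj₂ x∈int) → x∈int
      in (proj₁ ⊢ Int n m) , (Int n m , X.int-open (In n m) , id , id) , x∈int
       , λ g (h , h∈ , g≈h) y y∈int → Y.near⇒< {r = ε}
           (Y.near-resp (Setoid.sym Y.setoid (g≈h x)) (Setoid.sym Y.setoid (g≈h y))
             (proj₁ (proj₂ (proj₂ (cover n))) m h h∈ x∈G (X.int⊆ {P = In n m} y∈int (proj₂ y))))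
           (cut-≤ ε n≤q q∈ε)
      where
      cover = λ n → covers (1/1+-pos n)
      G = λ n → proj₁ (cover n)

      -- The interior of this set in `X` meets `F` in the interior of `F ∩ G n m` relative to `F`.
      In : ℕ → ℕ → Pred X.Carrier c
      In n m y = y ∈ F → y ∈ G n m

      Int : ℕ → ℕ → Pred X.Carrier c
      Int n m = X.int (In n m)

      V : ℕ → Pred X.Carrier c
      V k = let n , m = unpair k in ∁ (G n m) ∪ Int n m

      V-open : ∀ k → X.IsOpen (V k)
      V-open k = let n , m = unpair k in X.⊆int⇒open (V k) λ where
        (inj₁ y∉) →
          let q , 0<q , h = X.open⇒⊆int (∁ (G n m)) (proj₁ (proj₂ (cover n)) m) y∉
          in q , 0<q , λ yz → inj₁ (h yz)
        (inj₂ y∈) →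
          let q , 0<q , h = X.open⇒⊆int (Int n m) (X.int-open (In n m)) y∈
          in q , 0<q , λ yz → inj₂ (h yz)

      -- A relatively open `W` either has a point outside `G n m` or is contained in it, and then
      -- each point of `W` is interior.
      V-dense : ∀ k → Topology.IsDense (subspace (metricTopology X) F) (proj₁ ⊢ V k)
      V-dense k W (W′ , oW′ , W′⊆ , ⊆W′) (w , w∈) = case em {P = ∃[ v ] v ∈ W × proj₁ v ∉ G n m} of λ where
          (yes (v , v∈ , v∉)) → v , v∈ , inj₁ v∉
          (no ∄)              →
            let q , 0<q , h = X.open⇒⊆int W′ oW′ (⊆W′ w∈)
            in w , w∈ , inj₂ (q , 0<q , λ {y} wy y∈F → dne λ y∉ → ∄ ((y , y∈F) , W′⊆ (h wy) , y∉))
        where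
        n = proj₁ (unpair k)
        m = proj₂ (unpair k)

      generic = baire F F-closed (λ k → proj₁ ⊢ V k)
        (λ k → V k , V-open k , id , id) V-dense
        (λ _ → ⊤) (Topology.whole-open (subspace (metricTopology X) F)) ((z , z∈) , _)

      x = proj₁ generic
      x∈ = proj₂ (proj₂ generic)

    -- The union O of the balls admitting a small cover admits one by Lindelöf; an equicontinuity
    -- point of the complement of O would have such a ball.
    equicontinuityPoints⇒smallCovers : ∀ {s} → X.IsDenseSequence s →
      HasEquicontinuityPoints → SmallCovers
    equicontinuityPoints⇒smallCovers dense points {q} 0<q =
      σSmall-⊆ (λ {x} _ → dne λ x∉ → absurd (x , x∉)) σO
      where
      HasSmallBall : Pred X.Carrier _
      HasSmallBall x = ∃[ r ] 0ℚ ℚ.< r × σSmall q (X.near r x)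

      O : Pred X.Carrier c
      -- `HasSmallBall` quantifies over sequences of subsets, hence lies above level `c`.
      O x = resize (HasSmallBall x)

      O-open : X.IsOpen O
      O-open = X.⊆int⇒open O λ x∈ →
        let r , 0<r , σr = resize⁻ {P = HasSmallBall _} x∈
        in half r , half-pos 0<r , λ {y} xy → resize⁺ {P = HasSmallBall y}
             (half r , half-pos 0<r , σSmall-⊆ (X.near-halves xy) σr)

      σO : σSmall q O
      σO = σSmall-local dense O λ x∈ →
        let r , 0<r , σr = resize⁻ {P = HasSmallBall _} x∈ in r , 0<r , σSmall-⊆ proj₂ σr

      F : Pred X.Carrier c
      F = ∁ O

      F-closed : X.IsClosed F
      F-closed = X.∁-closed O O-open

      absurd : ¬ Satisfiable F
      absurd satF =
        let x , equi = points F F-closed satF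
            W , (W′ , oW′ , W′⊆ , ⊆W′) , x∈ , small =
              equi (fromℚ (half q)) (0ᴿ<fromℚ (half-pos 0<q))
            r , 0<r , ball⊆ = X.open⇒⊆int W′ oW′ (⊆W′ x∈)
            C = F ∩ λ y → Lift c (X.near r (proj₁ x) y)
            σC = σSmall-closed C (X.closed-∩ F _ F-closed (X.near-closed r (proj₁ x)))
              λ g g∈ {y} {z} (y∈ , lift xy) (z∈ , lift xz) → Y.near-halves
                (Y.near-sym (Y.<⇒near (small (g ↾ F) (↾∈restrict F g∈) (y , y∈) (W′⊆ (ball⊆ xy)))))
                (Y.<⇒near (small (g ↾ F) (↾∈restrict F g∈) (z , z∈) (W′⊆ (ball⊆ xz))))
        -- `O` and `C` cover the ball around the equicontinuity point, which would therefore belong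
        -- to `O`, although it lies in `F`.
        in proj₂ x (resize⁺ {P = HasSmallBall (proj₁ x)} (r , 0<r , σSmall-⊆
             (λ {y} xy → case em {P = y ∈ O} of λ where
               (yes y∈O) → inj₁ y∈O
               (no y∉O)  → inj₂ (y∉O , lift xy))
             (σSmall-∪ σO σC)))

-- The four conditions linked through `SmallCovers`.

proposition32 :
  (∀ {l} → ExcludedMiddle l) →
  ∀ {c e c′ e′ ℓ : Level} (X : MetricSpace c e) (Y : MetricSpace c′ e′) →
  let module X = MetricSpace X
      module Y = MetricSpace Y
      T = metricTopology X
      module T = Topology T
  in
  T.IsSeparable →
  (∀ F → T.IsClosed F → Topology.IsBaire (subspace T F)) →
  (A : Pred (Func X.setoid Y.setoid) ℓ) →
  let
    condition₁ = EquiBaireClassOne X Y A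
    condition₂ = ∀ ε → 0ᴿ <ᴿ ε →
      Σ[ G ∈ (ℕ → Pred X.Carrier c) ]
        (∀ m → T.IsClosed (G m)) × Universal (⋃ ℕ G) ×
        (∀ f → f ∈ A → ∀ m → diam[ Y ] image f (G m) < ε)
    condition₃ = Σ[ τ ∈ Topology X.setoid c (suc 0ℓ ⊔ c) ]
      IsMetrizable τ × Topology.IsSeparable τ ×
      (∀ U → T.IsOpen U → Topology.IsOpen τ U) ×
      (∀ U → Topology.IsOpen τ U → T.IsFσ U) ×
      Equicontinuous τ Y A
    condition₄ = ∀ F → T.IsClosed F → Satisfiable F →
      ∃[ x ] EquicontinuousAt (subspace T F) Y (restrict A F) x
  in
  (condition₁ ⇔ condition₂) × (condition₂ ⇔ condition₃) × (condition₃ ⇔ condition₄)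
proposition32 em X Y separable baire A =
    mk⇔ (smallCovers⇒closedCovers ∘ equiBaire⇒smallCovers dense)
        (smallCovers⇒equiBaire ∘ closedCovers⇒smallCovers)
  , mk⇔ (smallCovers⇒finerTopology dense ∘ closedCovers⇒smallCovers)
        (smallCovers⇒closedCovers ∘ finerTopology⇒smallCovers)
  , mk⇔ (smallCovers⇒equicontinuityPoints baire ∘ finerTopology⇒smallCovers)
        (smallCovers⇒finerTopology dense ∘ equicontinuityPoints⇒smallCovers dense)
  where
  open Classical em
  open Family X Y A
  dense = proj₂ (X.separable⇒denseSequence (metricTopology X) (λ _ → id) separable)
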